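{- Let $f_n$ denote the number of facets of ${\cal H}(B(n))$. Then (i) $f_n<n!\,n^{n-2}$ for every $n\ge2$; (ii) $f_n>2^{n-2}n^{n-2}$ for every $n\ge4$.
   Context: For $n\ge1$, $B(n)$ denotes the aperiodic Brandt semigroup: the set $(\{1,\dots,n\}\times\{1,\dots,n\})\cup\{0\}$, where $0$ is a zero element and $(i,j)(k,l)=(i,l)$ if $j=k$ and $(i,j)(k,l)=0$ otherwise. For $Y\subseteq B(n)$, $Y^+$ denotes the subsemigroup generated by $Y$ ($\emptyset^+=\emptyset$). The subsemigroup complex ${\cal H}(B(n))$ has vertex set $B(n)$, and a subset $X$ is a face iff it admits an enumeration $x_1,\dots,x_k$ with $\emptyset\subset\{x_1\}^+\subset\cdots\subset\{x_1,\dots,x_k\}^+$ (all inclusions strict); a facet is a face maximal under inclusion. -}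

module Defs where

open import Data.Nat using (ℕ; suc; _*_)
open import Data.Fin using (Fin)
open import Data.Fin.Properties using (_≟_)
open import Data.Fin.Subset using (Subset; _∈_; _∉_; _⊆_)
open import Data.Maybe using (Maybe; just; nothing)
open import Data.Product using (_×_; _,_; ∃)
open import Data.List using (List; take; length)
open import Data.List.Relation.Unary.Unique.Propositional using (Unique)
import Data.List.Membership.Propositional as LM
open import Data.Nat using (_<_)
open import Function.Bundles using (_⇔_)
open import Relation.Nullary using (¬_; yes; no)
open import Relation.Binary.PropositionalEquality using (_≡_)

-- Elements of the aperiodic Brandt semigroup B(n): nothing = 0, just (i , j) = (i,j)
B : ℕ → Set
B n = Maybe (Fin n × Fin n)

_·_ : ∀ {n} → B n → B n → B n
nothing · _ = nothing
just _ · nothing = nothing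
just (i , j) · just (k , l) with j ≟ k
... | yes _ = just (i , l)
... | no _ = nothing

-- Subsets of B(n) are characteristic vectors (Data.Fin.Subset) over
-- Fin (suc (n * n)), via the bijective encoding enc below.
module _ where
  open import Data.Fin using (zero; suc; combine; remQuot)
  open import Data.Product using (proj₁; proj₂)

  enc : ∀ {n} → B n → Fin (suc (n * n))
  enc nothing = zero
  enc (just (i , j)) = suc (combine i j)

SubB : ℕ → Set
SubB n = Subset (suc (n * n))

_∈B_ : ∀ {n} → B n → SubB n → Set
_∈B_ {n} x X = _∈_ {suc (n * n)} (enc x) X

_⊆B_ : ∀ {n} → SubB n → SubB n → Set
_⊆B_ {n} X Y = _⊆_ {suc (n * n)} X Y

data Gen {n : ℕ} (Y : List (B n)) : B n → Set where
  base : ∀ {y} → y LM.∈ Y → Gen Y y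
  mul  : ∀ {a b} → Gen Y a → Gen Y b → Gen Y (a · b)

StrictChain : ∀ {n} → List (B n) → Set
StrictChain {n} xs = ∀ (i : ℕ) → i < length xs →
  ∃ λ (z : B n) → Gen (take (suc i) xs) z × ¬ Gen (take i xs) z

IsFace : ∀ {n} → SubB n → Set
IsFace {n} X = ∃ λ (xs : List (B n)) →
  Unique xs × (∀ (x : B n) → (x ∈B X ⇔ x LM.∈ xs)) × StrictChain xs

IsFacet : ∀ {n} → SubB n → Set
IsFacet {n} X = IsFace {n} X × (∀ (Y : SubB n) → IsFace {n} Y → _⊆B_ {n} X Y → _⊆B_ {n} Y X)

FacetCount : ℕ → ℕ → Set
FacetCount n k = ∃ λ (L : List (SubB n)) →
  Unique L × (∀ (X : SubB n) → (X LM.∈ L ⇔ IsFacet {n} X)) × length L ≡ k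

{-# OPTIONS --safe #-}
module Submission where

open import Defs
open import Data.Bool using (Bool; true)
open import Data.Fin using (Fin; zero; suc; punchIn; punchOut; remQuot)
open import Data.Fin.Properties as Fin using
  ( _≟_; injective⇒≤; combine-remQuot; remQuot-combine; *↔×; 1↔⊤
  ; punchIn-punchOut; punchInᵢ≢i; punchIn-injective )
open import Data.Fin.Subset using (Subset; inside; outside)
open import Data.Fin.Subset.Properties as Subset using (⊆-antisym)
open import Data.List using
  ( List; []; _∷_; [_]; _++_; _∷ʳ_; length; lookup; map; filter; take; reverse; tabulate; allFin
  ; cartesianProduct; cartesianProductWith )
open import Data.List.Properties using
  ( length-++; length-map; filter-notAll; ∷-injective; ++-assoc; map-++; take-all; unfold-reverse; reverse-involutive )
open import Data.List.Membership.Propositional using (_∈_; _∉_; find; lose)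
open import Data.List.Membership.Propositional.Properties using
  ( ∈-lookup; ∈-++⁺ˡ; ∈-++⁺ʳ; ∈-++⁻; ∈-map⁺; ∈-map⁻; ∈-filter⁺; ∈-filter⁻; ∈-allFin; ∈-tabulate⁺; ∈-tabulate⁻
  ; ∈-cartesianProduct⁺; ∈-cartesianProduct⁻; ∈-cartesianProductWith⁺; ∈-cartesianProductWith⁻ )
open import Data.List.Relation.Binary.Permutation.Propositional using (_↭_; ↭-refl; ↭-sym; ↭-trans; prep; swap; ↭⇒↭ₛ)
open import Data.List.Relation.Binary.Permutation.Propositional.Properties using
  ( ∈-resp-↭; shift; ++⁺; drop-∷; ↭-length; ↭-reverse )
open import Data.List.Relation.Unary.All as All using (All; []; _∷_)
open import Data.List.Relation.Unary.All.Properties as All using (¬Any⇒All¬)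
open import Data.List.Relation.Unary.AllPairs using ([]; _∷_)
open import Data.List.Relation.Unary.Any using (here; there; index; any?)
open import Data.List.Relation.Unary.Any.Properties as Any using (lookup-index)
open import Data.List.Relation.Unary.Unique.Propositional using (Unique)
import Data.List.Relation.Unary.Unique.Propositional.Properties as Unique
open import Data.Maybe using (just; nothing)
import Data.Maybe.Properties as Maybe
open import Data.Nat using (ℕ; zero; suc; _+_; _*_; _^_; _∸_; _≤_; _<_; _>_; _!; z≤n; s≤s; _<?_)
open import Data.Nat.Properties using
  ( ≤-refl; ≤-trans; ≤-reflexive; <-≤-trans; <⇒≱; n≤1+n; n<1+n; m≤n+m; m≤n⇒m<n∨m≡n; allUpTo?
  ; +-comm; +-suc; +-identityʳ; +-cancelʳ-≡; +-monoˡ-≤; *-identityʳ; *-cancelˡ-≡; *-monoʳ-≤; *-monoʳ-<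
  ; ^-monoˡ-<; _!≢0; module ≤-Reasoning )
open import Data.Nat.Tactic.RingSolver using (solve-∀)
open import Data.Product using (∃; ∃₂; _×_; _,_; proj₁; proj₂)
open import Data.Product.Function.NonDependent.Propositional using (_×-↔_)
import Data.Product.Properties as Product
open import Data.Sum using (_⊎_; inj₁; inj₂)
open import Data.Unit using (⊤)
open import Data.Vec as Vec using ([]; _∷_)
open import Data.Vec.Properties using (lookup⇒[]=; []=⇒lookup; lookup∘tabulate; ∷-injectiveʳ)
open import Function using (_∘_; case_of_; _⇔_; mk⇔; Equivalence; _↔_; Inverse; Injection)
open import Function.Properties.Inverse using (↔-refl; ↔-sym; ↔-trans; ↔⇒↣)
open import Level using (0ℓ)
import Relation.Binary.Construct.Closure.ReflexiveTransitive as Star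
open Star using (Star; ε; _◅_; _◅◅_)
open import Relation.Binary.Definitions using (DecidableEquality)
open import Relation.Binary.PropositionalEquality using (_≡_; _≢_; refl; sym; trans; cong; cong₂; subst; setoid)
open import Relation.Nullary using (¬_; Dec; yes; no; does; contradiction)
open import Relation.Nullary.Decidable using
  ( map′; _×-dec_; _⊎-dec_; _→-dec_; ¬?; dec-true; decidable-stable; toWitness )
open import Relation.Unary using (Pred; Decidable)

-- Every facet contains 0 and all loops (v , v), and its other edges arise by splitting the vertices into
-- two nonempty parts σ | τ, taking all edges from σ to τ and a single edge back, and recursing on both parts.
-- Indeed, if (p , q) is the newest edge of a strict chain, the vertices reachable from p without it form a
-- suitable τ. The back edges form a spanning tree, which the linear order underlying the recursion arranges
-- in a word; an edge u → v is present iff the word can be cut at some tree edge such that u is joined to one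
-- end of it by earlier tree edges and v to the other end by later ones. Thus the word determines the facet.
-- Orienting the tree edges towards a root, there are at most (n-1)! (n-1)^(n-1) words, which gives (i).
-- For (ii), splittings whose left parts are always single vertices already yield n! (n-1)! / 2 facets.

private variable
  A : Set
  V : Set
  n : ℕ

-- Lists without repetitions

lookup-injective : ∀ {xs : List A} → Unique xs → ∀ i j → lookup xs i ≡ lookup xs j → i ≡ j
lookup-injective (_ ∷ _) zero zero _ = refl
lookup-injective (x∉ ∷ _) zero (suc j) eq = contradiction eq (All.lookup x∉ (∈-lookup j))
lookup-injective (x∉ ∷ _) (suc i) zero eq = contradiction (sym eq) (All.lookup x∉ (∈-lookup i))
lookup-injective (_ ∷ u) (suc i) (suc j) eq = cong suc (lookup-injective u i j eq)

-- The map may use the membership proof: later the code of a facet is extracted from the proof that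
-- it is a facet.
unique-length-≤ : ∀ {xs : List A} → Unique xs → (f : ∀ {x} → x ∈ xs → Fin n) →
  (∀ {x y} (p : x ∈ xs) (q : y ∈ xs) → f p ≡ f q → x ≡ y) → length xs ≤ n
unique-length-≤ u f inj = injective⇒≤ λ {i} {j} eq → lookup-injective u i j (inj (∈-lookup i) (∈-lookup j) eq)

unique-⊆-length : ∀ {xs ys : List A} → Unique xs → (∀ {x} → x ∈ xs → x ∈ ys) → length xs ≤ length ys
unique-⊆-length {ys = ys} u xs⊆ys = unique-length-≤ u (index ∘ xs⊆ys) λ p q eq →
  trans (lookup-index (xs⊆ys p)) (trans (cong (lookup ys) eq) (sym (lookup-index (xs⊆ys q))))

-- Pigeonhole: a `y` missing from `xs` would make `y ∷ xs` a repetition-free list within `ys` that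
-- is longer than `ys`.
unique-⊆-antisym : DecidableEquality A → ∀ {xs ys : List A} → Unique xs → (∀ {x} → x ∈ xs → x ∈ ys) →
  length ys ≤ length xs → ∀ {y} → y ∈ ys → y ∈ xs
unique-⊆-antisym _≟A_ {xs} {ys} u xs⊆ys len {y} y∈ys with y ∈? xs
  where open import Data.List.Membership.DecPropositional _≟A_ using (_∈?_)
... | yes y∈xs = y∈xs
... | no y∉xs = contradiction len (<⇒≱ (unique-⊆-length (¬Any⇒All¬ xs y∉xs ∷ u)
        λ { (here refl) → y∈ys ; (there p) → xs⊆ys p }))

filter-↭ : ∀ {P : Pred A 0ℓ} (P? : Decidable P) xs → filter (¬? ∘ P?) xs ++ filter P? xs ↭ xs
filter-↭ P? [] = ↭-refl
filter-↭ P? (x ∷ xs) with P? x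
... | yes _ = ↭-trans (shift x (filter (¬? ∘ P?) xs) _) (prep x (filter-↭ P? xs))
... | no _ = prep x (filter-↭ P? xs)

++-disjoint : ∀ {xs ys : List A} → Unique (xs ++ ys) → ∀ {x} → x ∈ xs → x ∉ ys
++-disjoint {xs = _ ∷ xs} (x∉ ∷ _) (here refl) q = All.lookup x∉ (∈-++⁺ʳ xs q) refl
++-disjoint {xs = _ ∷ _} (_ ∷ u) (there p) q = ++-disjoint u p q

++-uniqueˡ : ∀ (xs : List A) {ys} → Unique (xs ++ ys) → Unique xs
++-uniqueˡ [] _ = []
++-uniqueˡ (x ∷ xs) (x∉ ∷ u) = All.++⁻ˡ xs x∉ ∷ ++-uniqueˡ xs u

++-uniqueʳ : ∀ (xs : List A) {ys} → Unique (xs ++ ys) → Unique ys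
++-uniqueʳ [] u = u
++-uniqueʳ (_ ∷ xs) (_ ∷ u) = ++-uniqueʳ xs u

-- Reachability and valid edge sequences

Reach : List (V × V) → V → V → Set
Reach es = Star (λ u v → (u , v) ∈ es)

Reach-mono : ∀ {es fs : List (V × V)} → (∀ {e} → e ∈ es → e ∈ fs) → ∀ {u v} → Reach es u v → Reach fs u v
Reach-mono es⊆fs = Star.map es⊆fs

-- A walk through the first listed edge can be shortened so as to traverse it once: the part before
-- its last traversal is replaced by a walk to `p` without it.
reach? : DecidableEquality V → ∀ es (u v : V) → Dec (Reach es u v)
reach? _≟V_ [] u v = map′ (λ { refl → ε }) (λ { ε → refl ; (() ◅ _) }) (u ≟V v)
reach? {V} _≟V_ ((p , q) ∷ es) u v =
  map′ join split (reach? _≟V_ es u v ⊎-dec (reach? _≟V_ es u p ×-dec reach? _≟V_ es q v))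
  where
  join : Reach es u v ⊎ Reach es u p × Reach es q v → Reach ((p , q) ∷ es) u v
  join (inj₁ r) = Reach-mono there r
  join (inj₂ (r , s)) = Reach-mono there r ◅◅ here refl ◅ Reach-mono there s
  split : ∀ {u v} → Reach ((p , q) ∷ es) u v → Reach es u v ⊎ Reach es u p × Reach es q v
  split ε = inj₁ ε
  split (here refl ◅ r) with split r
  ... | inj₁ s = inj₂ (ε , s)
  ... | inj₂ (_ , s) = inj₂ (ε , s)
  split (there e ◅ r) with split r
  ... | inj₁ s = inj₁ (e ◅ s)
  ... | inj₂ (s , s′) = inj₂ (e ◅ s , s′)

-- Edge sequences are listed with the newest edge first.
data Valid {V : Set} : List (V × V) → Set where
  [] : Valid []
  _∷_ : ∀ {u v es} → ¬ Reach es u v → Valid es → Valid ((u , v) ∷ es)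

valid-irreflexive : ∀ {es} {u v : V} → Valid es → (u , v) ∈ es → u ≢ v
valid-irreflexive (¬r ∷ _) (here refl) refl = ¬r ε
valid-irreflexive (_ ∷ val) (there p) = valid-irreflexive val p

valid⇒unique : ∀ {es : List (V × V)} → Valid es → Unique es
valid⇒unique [] = []
valid⇒unique {es = _ ∷ es} (¬r ∷ val) = ¬Any⇒All¬ es (λ e∈ → ¬r (e∈ ◅ ε)) ∷ valid⇒unique val

valid-filter : ∀ {P : Pred (V × V) 0ℓ} (P? : Decidable P) {es} → Valid es → Valid (filter P? es)
valid-filter P? [] = []
valid-filter P? {(u , v) ∷ es} (¬r ∷ val) with P? (u , v)
... | yes _ = ¬r ∘ Reach-mono (proj₁ ∘ ∈-filter⁻ P?) ∷ valid-filter P? val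
... | no _ = valid-filter P? val

-- Splitting trees and their edge sets

data Tree {V : Set} : List V → Set where
  leaf : ∀ v → Tree [ v ]
  node : ∀ {σ τ a b} → Tree σ → Tree τ → a ∈ σ → b ∈ τ → Tree (σ ++ τ)

-- The back edge is the newest and the forward edges are the oldest; this order makes the sequence
-- valid.
edges : ∀ {σ : List V} → Tree σ → List (V × V)
edges (leaf _) = []
edges (node {σ} {τ} {a} {b} s t _ _) = (b , a) ∷ edges s ++ edges t ++ cartesianProduct σ τ

module _ {σ τ : List V} {a b} (s : Tree σ) (t : Tree τ) (a∈ : a ∈ σ) (b∈ : b ∈ τ) where
  data NodeEdge (u v : V) : Set where
    back : u ≡ b → v ≡ a → NodeEdge u v
    left : (u , v) ∈ edges s → NodeEdge u v
    right : (u , v) ∈ edges t → NodeEdge u v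
    forward : u ∈ σ → v ∈ τ → NodeEdge u v

  node-edge⁻ : ∀ {u v} → (u , v) ∈ edges (node s t a∈ b∈) → NodeEdge u v
  node-edge⁻ (here refl) = back refl refl
  node-edge⁻ (there p) with ∈-++⁻ (edges s) p
  ... | inj₁ q = left q
  ... | inj₂ q with ∈-++⁻ (edges t) q
  ... | inj₁ r = right r
  ... | inj₂ r with ∈-cartesianProduct⁻ σ τ r
  ... | u∈ , v∈ = forward u∈ v∈

  node-edge⁺ : ∀ {u v} → NodeEdge u v → (u , v) ∈ edges (node s t a∈ b∈)
  node-edge⁺ (back refl refl) = here refl
  node-edge⁺ (left p) = there (∈-++⁺ˡ p)
  node-edge⁺ (right p) = there (∈-++⁺ʳ (edges s) (∈-++⁺ˡ p))
  node-edge⁺ (forward u∈ v∈) = there (∈-++⁺ʳ (edges s) (∈-++⁺ʳ (edges t) (∈-cartesianProduct⁺ u∈ v∈)))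

edges-within : ∀ {σ} (t : Tree σ) {u v : V} → (u , v) ∈ edges t → u ∈ σ × v ∈ σ
edges-within (node {σ} s t a∈ b∈) p with node-edge⁻ s t a∈ b∈ p
... | back refl refl = ∈-++⁺ʳ σ b∈ , ∈-++⁺ˡ a∈
... | left q = let u∈ , v∈ = edges-within s q in ∈-++⁺ˡ u∈ , ∈-++⁺ˡ v∈
... | right q = let u∈ , v∈ = edges-within t q in ∈-++⁺ʳ σ u∈ , ∈-++⁺ʳ σ v∈
... | forward u∈ v∈ = ∈-++⁺ˡ u∈ , ∈-++⁺ʳ σ v∈

length-cartesianProduct : ∀ {B : Set} (xs : List A) (ys : List B) →
  length (cartesianProduct xs ys) ≡ length xs * length ys
length-cartesianProduct [] ys = refl
length-cartesianProduct (x ∷ xs) ys = trans (length-++ (map (x ,_) ys))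
  (cong₂ _+_ (length-map (x ,_) ys) (length-cartesianProduct xs ys))

-- A tree on k vertices has k(k+1)/2 - 1 edges whatever its shape, here freed of halving and
-- subtraction. Only the independence of the shape matters later: it makes all tree sets equally
-- large.
double-length-edges : ∀ {σ : List V} (t : Tree σ) → 2 * length (edges t) + 2 ≡ length σ * suc (length σ)
double-length-edges (leaf _) = refl
double-length-edges (node {σ} {τ} s t _ _)
  rewrite length-++ (edges s) {edges t ++ cartesianProduct σ τ} | length-++ (edges t) {cartesianProduct σ τ}
        | length-cartesianProduct σ τ | length-++ σ {τ} =
  trans (regroup (length (edges s)) (length (edges t)) _)
    (trans (cong₂ (λ x y → x + y + 2 * (length σ * length τ)) (double-length-edges s) (double-length-edges t))
      (square (length σ) (length τ)))
  where
  regroup : ∀ x y z → 2 * suc (x + (y + z)) + 2 ≡ (2 * x + 2) + (2 * y + 2) + 2 * z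
  regroup = solve-∀
  square : ∀ x y → x * suc x + y * suc y + 2 * (x * y) ≡ (x + y) * suc (x + y)
  square = solve-∀

length-edges-cong : ∀ {σ τ : List V} (s : Tree σ) (t : Tree τ) → length σ ≡ length τ →
  length (edges s) ≡ length (edges t)
length-edges-cong s t eq = *-cancelˡ-≡ _ _ 2 (+-cancelʳ-≡ 2 _ _
  (trans (double-length-edges s) (trans (cong (λ k → k * suc k) eq) (sym (double-length-edges t)))))

-- Validity of the edges of a tree

module _ {σ τ : List V} (disjoint : ∀ {v} → v ∈ σ → v ∉ τ) where
  module _ {es fs gs : List (V × V)}
    (within-σ : ∀ {u v} → (u , v) ∈ es → u ∈ σ × v ∈ σ)
    (within-τ : ∀ {u v} → (u , v) ∈ fs → u ∈ τ × v ∈ τ)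
    (across : ∀ {u v} → (u , v) ∈ gs → u ∈ σ × v ∈ τ) where

    -- No edge leaves `τ`: those of `es` and `gs` start in `σ`, which is disjoint from it.
    reach-from-τ : ∀ {u v} → Reach (es ++ fs ++ gs) u v → u ∈ τ → v ∈ τ × Reach fs u v
    reach-from-τ ε u∈ = u∈ , ε
    reach-from-τ (p ◅ r) u∈ with ∈-++⁻ es p
    ... | inj₁ q = contradiction u∈ (disjoint (proj₁ (within-σ q)))
    ... | inj₂ q with ∈-++⁻ fs q
    ... | inj₂ q′ = contradiction u∈ (disjoint (proj₁ (across q′)))
    ... | inj₁ q′ = let v∈ , r′ = reach-from-τ r (proj₂ (within-τ q′)) in v∈ , q′ ◅ r′

    -- A walk that has entered `τ` cannot come back, so one that ends in `σ` has used `es` only.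
    reach-to-σ : ∀ {u v} → Reach (es ++ fs ++ gs) u v → u ∈ σ → v ∈ σ → Reach es u v
    reach-to-σ ε _ _ = ε
    reach-to-σ (p ◅ r) u∈ v∈ with ∈-++⁻ es p
    ... | inj₁ q = q ◅ reach-to-σ r (proj₂ (within-σ q)) v∈
    ... | inj₂ q with ∈-++⁻ fs q
    ... | inj₁ q′ = contradiction (proj₁ (within-τ q′)) (disjoint u∈)
    ... | inj₂ q′ = contradiction (proj₁ (reach-from-τ r (proj₂ (across q′)))) (disjoint v∈)

  valid-node : ∀ {es fs gs} →
    (∀ {u v} → (u , v) ∈ es → u ∈ σ × v ∈ σ) →
    (∀ {u v} → (u , v) ∈ fs → u ∈ τ × v ∈ τ) →
    (∀ {u v} → (u , v) ∈ gs → u ∈ σ × v ∈ τ) →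
    Valid es → Valid fs → Unique gs → Valid (es ++ fs ++ gs)
  valid-node wσ wτ wστ (_∷_ {u} {v} ¬r es) fs gs =
    (λ r → ¬r (reach-to-σ (wσ ∘ there) wτ wστ r (proj₁ (wσ (here refl))) (proj₂ (wσ (here refl)))))
    ∷ valid-node (wσ ∘ there) wτ wστ es fs gs
  valid-node wσ wτ wστ [] (¬r ∷ fs) gs =
    (λ r → ¬r (proj₂ (reach-from-τ {es = []} (λ ()) (wτ ∘ there) wστ r (proj₁ (wτ (here refl))))))
    ∷ valid-node wσ (wτ ∘ there) wστ [] fs gs
  valid-node wσ wτ wστ [] [] [] = []
  valid-node wσ wτ wστ [] [] (_∷_ {g} {gs} g∉ gs!) =
    -- Edges from `σ` to `τ` cannot be composed: a walk is empty, a single edge, or impossible.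
    (λ { ε → disjoint (proj₁ (wστ (here refl))) (proj₂ (wστ (here refl)))
       ; (p ◅ ε) → All.lookup g∉ p refl
       ; (p ◅ q ◅ _) → disjoint (proj₁ (wστ (there q))) (proj₂ (wστ (there p))) })
    ∷ valid-node wσ wτ (wστ ∘ there) [] [] gs!

valid-edges : ∀ {σ : List V} (t : Tree σ) → Unique σ → Valid (edges t)
valid-edges (leaf _) _ = []
valid-edges (node {σ} {τ} s t a∈ b∈) u =
  -- The back edge is new because walks from `b` without it stay in `τ`.
  (λ r → disjoint a∈ (proj₁ (reach-from-τ disjoint (edges-within s) (edges-within t) (∈-cartesianProduct⁻ σ τ) r b∈)))
  ∷ valid-node disjoint (edges-within s) (edges-within t) (∈-cartesianProduct⁻ σ τ)
      (valid-edges s (++-uniqueˡ σ u)) (valid-edges t (++-uniqueʳ σ u))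
      (Unique.cartesianProduct⁺ (++-uniqueˡ σ u) (++-uniqueʳ σ u))
  where disjoint = ++-disjoint u

-- Covering a valid sequence by a tree

-- `Low` is to become the right part of a splitting and its complement the left part; `b` and `a`
-- are to be the ends of the back edge.
record Cut {V : Set} (vs : List V) (es : List (V × V)) : Set₁ where
  field
    Low : V → Set
    low? : Decidable Low
    {b a} : V
    b∈ : b ∈ vs
    a∈ : a ∈ vs
    low-b : Low b
    high-a : ¬ Low a
    crossing : ∀ {u v} → (u , v) ∈ es → u ∈ vs → v ∈ vs → Low u → ¬ Low v → u ≡ b × v ≡ a

-- The vertices reachable from p before the newest edge (p , q) was added are left by that edge only.
cut : DecidableEquality V → ∀ {x y} {vs : List V} {es} → Unique (x ∷ y ∷ vs) → Valid es → Cut (x ∷ y ∷ vs) es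
cut {V} _≟V_ {x} {y} {vs} {es} ((x≢y ∷ _) ∷ _) val =
  -- Edges with an end outside the list are discarded first, so that both ends of the newest
  -- remaining edge lie in the list.
  restrict (cut-within _ (valid-filter inside? val) (λ p → proj₂ (∈-filter⁻ inside? {xs = es} p)))
  where
  open import Data.List.Membership.DecPropositional _≟V_ using (_∈?_)
  ws = x ∷ y ∷ vs
  Inside : V × V → Set
  Inside (u , v) = u ∈ ws × v ∈ ws
  inside? : Decidable Inside
  inside? (u , v) = u ∈? ws ×-dec v ∈? ws
  cut-within : ∀ fs → Valid fs → (∀ {e} → e ∈ fs → Inside e) → Cut ws fs
  -- Without edges every nonempty proper subset would do as `Low`; the singleton of `x` is taken.
  cut-within [] _ _ = record
    { Low = _≡ x ; low? = _≟V x ; b∈ = here refl ; a∈ = there (here refl)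
    ; low-b = refl ; high-a = x≢y ∘ sym ; crossing = λ () }
  cut-within ((p , q) ∷ fs) (¬r ∷ _) within = record
    { Low = Reach fs p ; low? = reach? _≟V_ fs p
    ; b∈ = proj₁ (within (here refl)) ; a∈ = proj₂ (within (here refl))
    ; low-b = ε ; high-a = ¬r
    ; crossing = λ { (here refl) _ _ _ _ → refl , refl
                   ; (there e) _ _ r ¬r′ → contradiction (r ◅◅ e ◅ ε) ¬r′ } }
  restrict : Cut ws (filter inside? es) → Cut ws es
  restrict c = record
    { Low = Low ; low? = low? ; b∈ = b∈ ; a∈ = a∈ ; low-b = low-b ; high-a = high-a
    ; crossing = λ e u∈ v∈ → crossing (∈-filter⁺ inside? e (u∈ , v∈)) u∈ v∈ }
    where open Cut c

CoveringTree : (vs : List V) (es : List (V × V)) → Set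
CoveringTree vs es = ∃₂ λ σ (t : Tree σ) → σ ↭ vs ×
  (∀ {u v} → (u , v) ∈ es → u ∈ vs → v ∈ vs → (u , v) ∈ edges t)

-- Recursion on the two sides of a cut. Both calls keep the whole of `es`, because only edges
-- between the given vertices have to be covered. The bound `k` makes the recursion on filtered
-- lists structural.
covering-tree : DecidableEquality V → ∀ k (vs : List V) {es} → length vs ≤ k → Unique vs → ∃ (_∈ vs) →
  Valid es → CoveringTree vs es
covering-tree _ _ [] _ _ (_ , ()) _
covering-tree _ _ (x ∷ []) _ _ _ val = [ x ] , leaf x , ↭-refl , λ where
  e (here refl) (here refl) → contradiction refl (valid-irreflexive val e)
covering-tree _≟V_ (suc k) vs@(_ ∷ _ ∷ _) {es} len u _ val =
  let σ , s , σ↭ , s-covers = covering-tree _≟V_ k highs (shorter high? b∈ (λ ¬low → ¬low low-b))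
                                 (Unique.filter⁺ high? u) (_ , a∈high) val
      τ , t , τ↭ , t-covers = covering-tree _≟V_ k lows (shorter low? a∈ high-a)
                                 (Unique.filter⁺ low? u) (_ , b∈low) val
      a∈σ = ∈-resp-↭ (↭-sym σ↭) a∈high
      b∈τ = ∈-resp-↭ (↭-sym τ↭) b∈low
      covers : ∀ {u v} → (u , v) ∈ es → u ∈ vs → v ∈ vs → NodeEdge s t a∈σ b∈τ u v
      covers {u} {v} e u∈ v∈ = case (low? u , low? v) of λ where
        (yes lu , yes lv) → right (t-covers e (∈-filter⁺ low? u∈ lu) (∈-filter⁺ low? v∈ lv))
        (no hu , no hv) → left (s-covers e (∈-filter⁺ high? u∈ hu) (∈-filter⁺ high? v∈ hv))
        (no hu , yes lv) → forward (∈-resp-↭ (↭-sym σ↭) (∈-filter⁺ high? u∈ hu))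
                                   (∈-resp-↭ (↭-sym τ↭) (∈-filter⁺ low? v∈ lv))
        (yes lu , no hv) → let u≡b , v≡a = crossing e u∈ v∈ lu hv in back u≡b v≡a
  in σ ++ τ , node s t a∈σ b∈τ , ↭-trans (++⁺ σ↭ τ↭) (filter-↭ low? vs) ,
     λ e u∈ v∈ → node-edge⁺ s t a∈σ b∈τ (covers e u∈ v∈)
  where
  open Cut (cut _≟V_ u val)
  high? : Decidable (¬_ ∘ Low)
  high? = ¬? ∘ low?
  highs = filter high? vs
  lows = filter low? vs
  a∈high = ∈-filter⁺ high? a∈ high-a
  b∈low = ∈-filter⁺ low? b∈ low-b
  shorter : ∀ {P : Pred _ 0ℓ} (P? : Decidable P) {x} → x ∈ vs → ¬ P x → length (filter P? vs) ≤ k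
  shorter P? x∈ ¬px with s≤s le ← ≤-trans (filter-notAll P? vs (lose x∈ ¬px)) len = le

-- Words of tree edges and the arcs they determine

-- The orientation of a letter only records which end is the child; connectivity and arcs refer to
-- the undirected edge.
Joins : V × V → V → V → Set
Joins e u v = e ≡ (u , v) ⊎ e ≡ (v , u)

Conn : List (V × V) → V → V → Set
Conn w = Star (λ u v → ∃ λ e → e ∈ w × Joins e u v)

Conn-mono : ∀ {w w′ : List (V × V)} → (∀ {e} → e ∈ w → e ∈ w′) → ∀ {u v} → Conn w u v → Conn w′ u v
Conn-mono w⊆w′ = Star.map λ (e , e∈ , j) → e , w⊆w′ e∈ , j

Arc : List (V × V) → V → V → Set
Arc w u v = ∃₂ λ x e → ∃ λ y → w ≡ x ++ e ∷ y × ∃₂ λ c d → Joins e c d × Conn x u c × Conn y d v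

-- The tree edges of the decomposition in the order of the gaps of σ which they bridge,
-- each written as (child , parent) with respect to the root r.
word : ∀ {σ r} → Tree {V} σ → r ∈ σ → List (V × V)
word (leaf _) _ = []
word (node {σ} {τ} {a} {b} s t a∈ b∈) r∈ with ∈-++⁻ σ r∈
... | inj₁ r∈σ = word s r∈σ ++ (b , a) ∷ word t b∈
... | inj₂ r∈τ = word s a∈ ++ (a , b) ∷ word t r∈τ

module _ {σ τ : List V} {a b} (s : Tree σ) (t : Tree τ) (a∈ : a ∈ σ) (b∈ : b ∈ τ) where
  -- Covers both positions of the root: they differ only in the roots chosen for the parts and in
  -- the orientation of the bridge `e`, which do not affect arcs.
  record NodeWord (w : List (V × V)) : Set where
    constructor nodeWord
    field
      {p q} : V
      p∈ : p ∈ σ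
      q∈ : q ∈ τ
      {e} : V × V
      joins : Joins e a b
      word≡ : w ≡ word s p∈ ++ e ∷ word t q∈

  node-word : ∀ {r} (r∈ : r ∈ σ ++ τ) → NodeWord (word (node s t a∈ b∈) r∈)
  node-word r∈ with ∈-++⁻ σ r∈
  ... | inj₁ r∈σ = nodeWord r∈σ b∈ (inj₂ refl) refl
  ... | inj₂ r∈τ = nodeWord a∈ r∈τ (inj₁ refl) refl

joins-sym : ∀ {e} {u v : V} → Joins e u v → Joins e v u
joins-sym (inj₁ eq) = inj₂ eq
joins-sym (inj₂ eq) = inj₁ eq

joins-unique : ∀ {e} {a b c d : V} → Joins e a b → Joins e c d → (c ≡ a × d ≡ b) ⊎ (c ≡ b × d ≡ a)
joins-unique (inj₁ refl) (inj₁ refl) = inj₁ (refl , refl)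
joins-unique (inj₁ refl) (inj₂ refl) = inj₂ (refl , refl)
joins-unique (inj₂ refl) (inj₁ refl) = inj₂ (refl , refl)
joins-unique (inj₂ refl) (inj₂ refl) = inj₁ (refl , refl)

conn-sym : ∀ {w} {u v : V} → Conn w u v → Conn w v u
conn-sym = Star.reverse λ (e , e∈ , j) → e , e∈ , joins-sym j

word-joins-within : ∀ {σ r} (t : Tree σ) (r∈ : r ∈ σ) {e} → e ∈ word t r∈ → ∀ {u v : V} → Joins e u v → u ∈ σ × v ∈ σ
word-joins-within (leaf _) _ ()
word-joins-within (node {σ} s t a∈ b∈) r∈ e∈ j
  with nodeWord p∈ q∈ ab word≡ ← node-word s t a∈ b∈ r∈
  with ∈-++⁻ (word s p∈) (subst (_ ∈_) word≡ e∈)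
... | inj₁ e∈s = let u∈ , v∈ = word-joins-within s p∈ e∈s j in ∈-++⁺ˡ u∈ , ∈-++⁺ˡ v∈
... | inj₂ (there e∈t) = let u∈ , v∈ = word-joins-within t q∈ e∈t j in ∈-++⁺ʳ σ u∈ , ∈-++⁺ʳ σ v∈
... | inj₂ (here refl) with joins-unique ab j
... | inj₁ (refl , refl) = ∈-++⁺ˡ a∈ , ∈-++⁺ʳ σ b∈
... | inj₂ (refl , refl) = ∈-++⁺ʳ σ b∈ , ∈-++⁺ˡ a∈

word-connected : ∀ {σ r} (t : Tree σ) (r∈ : r ∈ σ) {u v : V} → u ∈ σ → v ∈ σ → Conn (word t r∈) u v
word-connected (leaf _) _ (here refl) (here refl) = ε
word-connected {V} (node {σ} {τ} {a} {b} s t a∈ b∈) r∈ {u} {v} u∈ v∈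
  with nodeWord p∈ q∈ {e} ab word≡ ← node-word s t a∈ b∈ r∈ =
  subst (λ w → Conn w u v) (sym word≡) (to-a u∈ ◅◅ conn-sym (to-a v∈))
  where
  to-a : ∀ {x} → x ∈ σ ++ τ → Conn (word s p∈ ++ e ∷ word t q∈) x a
  to-a x∈ with ∈-++⁻ σ x∈
  ... | inj₁ x∈σ = Conn-mono ∈-++⁺ˡ (word-connected s p∈ x∈σ a∈)
  ... | inj₂ x∈τ = Conn-mono (∈-++⁺ʳ (word s p∈) ∘ there) (word-connected t q∈ x∈τ b∈)
                   ◅◅ (e , ∈-++⁺ʳ (word s p∈) (here refl) , joins-sym ab) ◅ ε

conn-within : ∀ {σ : List V} {w} → (∀ {e} → e ∈ w → ∀ {u v} → Joins e u v → u ∈ σ × v ∈ σ) →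
  ∀ {u v} → Conn w u v → u ∈ σ → v ∈ σ
conn-within _ ε u∈ = u∈
conn-within within ((_ , e∈ , j) ◅ r) _ = conn-within within r (proj₂ (within e∈ j))

conn-outside : ∀ {σ : List V} {w} → (∀ {e} → e ∈ w → ∀ {u v} → Joins e u v → u ∈ σ × v ∈ σ) →
  ∀ {u v} → u ∉ σ → Conn w u v → v ≡ u
conn-outside _ _ ε = refl
conn-outside within u∉ ((_ , e∈ , j) ◅ _) = contradiction (proj₁ (within e∈ j)) u∉

-- A walk that leaves σ through a bridge ab has to return to a.
bridge : ∀ {σ τ : List V} (disjoint : ∀ {v} → v ∈ σ → v ∉ τ) {w w′ a b} → a ∈ σ → b ∈ τ →
  (∀ {e} → e ∈ w′ → ∀ {u v} → Joins e u v → e ∈ w × u ∈ σ × v ∈ σ ⊎ Joins (a , b) u v ⊎ u ∈ τ × v ∈ τ) →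
  ∀ {u v} → Conn w′ u v → v ∈ σ → (u ∈ σ → Conn w u v) × (u ∈ τ → Conn w a v)
bridge disjoint a∈ b∈ split ε v∈ = (λ _ → ε) , λ v∈τ → contradiction v∈τ (disjoint v∈)
bridge disjoint a∈ b∈ split ((e , e∈ , j) ◅ r) v∈ with bridge disjoint a∈ b∈ split r v∈ | split e∈ j
... | from-σ , from-τ | inj₁ (e∈w , u∈ , u′∈) =
  (λ _ → (e , e∈w , j) ◅ from-σ u′∈) , λ u∈τ → contradiction u∈τ (disjoint u∈)
... | from-σ , from-τ | inj₂ (inj₁ (inj₁ refl)) = (λ _ → from-τ b∈) , λ a∈τ → contradiction a∈τ (disjoint a∈)
... | from-σ , from-τ | inj₂ (inj₁ (inj₂ refl)) = (λ b∈σ → contradiction b∈ (disjoint b∈σ)) , λ _ → from-σ a∈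
... | from-σ , from-τ | inj₂ (inj₂ (u∈ , u′∈)) = (λ u∈σ → contradiction u∈ (disjoint u∈σ)) , λ _ → from-τ u′∈

-- Compares two ways of singling out an entry of the same list; the constructors tell where `e`
-- stands relative to `f`.
data Split (x : List A) (e : A) (y w : List A) (f : A) (z : List A) : Set where
  before : ∀ m → w ≡ x ++ e ∷ m → y ≡ m ++ f ∷ z → Split x e y w f z
  same : x ≡ w → e ≡ f → y ≡ z → Split x e y w f z
  after : ∀ m → x ≡ w ++ f ∷ m → z ≡ m ++ e ∷ y → Split x e y w f z

split-++ : ∀ (x : List A) {e y} w {f z} → w ++ f ∷ z ≡ x ++ e ∷ y → Split x e y w f z
split-++ [] [] refl = same refl refl refl
split-++ [] (_ ∷ w) refl = before w refl refl
split-++ (_ ∷ x) [] refl = after x refl refl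
split-++ (_ ∷ x) (_ ∷ w) eq with refl , eq′ ← ∷-injective eq with split-++ x w eq′
... | before m refl refl = before m refl refl
... | same refl refl refl = same refl refl refl
... | after m refl refl = after m refl refl

-- The word is cut at the bridge of the node that contributes the edge. For a forward edge, the
-- letters of the left part lead from `u` to the bridge and those of the right part from the bridge
-- to `v`; for a back edge both walks are empty. Enclosing nodes only add letters on either side.
edge⇒arc : ∀ {σ r} (t : Tree σ) (r∈ : r ∈ σ) {u v : V} → (u , v) ∈ edges t → Arc (word t r∈) u v
edge⇒arc (leaf _) _ ()
edge⇒arc (node s t a∈ b∈) r∈ uv
  with nodeWord p∈ q∈ {e} ab word≡ ← node-word s t a∈ b∈ r∈ rewrite word≡
  with node-edge⁻ s t a∈ b∈ uv
... | back refl refl = word s p∈ , e , word t q∈ , refl , _ , _ , joins-sym ab , ε , ε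
... | forward u∈ v∈ = word s p∈ , e , word t q∈ , refl , _ , _ , ab ,
        word-connected s p∈ u∈ a∈ , word-connected t q∈ b∈ v∈
... | left uv∈ =
  let x , f , y , eq , c , d , j , uc , dv = edge⇒arc s p∈ uv∈
  in x , f , y ++ e ∷ word t q∈ , trans (cong (_++ _) eq) (++-assoc x _ _) , c , d , j , uc , Conn-mono ∈-++⁺ˡ dv
... | right uv∈ =
  let x , f , y , eq , c , d , j , uc , dv = edge⇒arc t q∈ uv∈
  in word s p∈ ++ e ∷ x , f , y , trans (cong (λ w → word s p∈ ++ e ∷ w) eq) (sym (++-assoc (word s p∈) _ _)) ,
     c , d , j , Conn-mono (∈-++⁺ʳ (word s p∈) ∘ there) uc , dv

-- Compares the cut with the position of the bridge. A cut at the bridge yields a forward or the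
-- back edge; a cut on one side yields a forward edge, or an arc within that part once excursions
-- over the bridge are removed.
arc⇒edge : ∀ {σ r} (t : Tree σ) (r∈ : r ∈ σ) → Unique σ → ∀ {u v : V} → Arc (word t r∈) u v → (u , v) ∈ edges t
arc⇒edge (leaf _) _ _ ([] , _ , _ , () , _)
arc⇒edge (leaf _) _ _ (_ ∷ _ , _ , _ , () , _)
arc⇒edge (node {σ} {τ} {a} {b} s t a∈ b∈) r∈ uniq {u} {v} (x , f , y , eq , c , d , j , uc , dv)
  with nodeWord p∈ q∈ {e} ab word≡ ← node-word s t a∈ b∈ r∈ =
  node-edge⁺ s t a∈ b∈ (from-split (split-++ x (word s p∈) (trans (sym word≡) eq)))
  where
  disjoint : ∀ {v} → v ∈ σ → v ∉ τ
  disjoint = ++-disjoint uniq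
  within-s : ∀ {w} → (∀ {e} → e ∈ w → e ∈ word s p∈) → ∀ {e} → e ∈ w → ∀ {u v} → Joins e u v → u ∈ σ × v ∈ σ
  within-s w⊆ e∈ = word-joins-within s p∈ (w⊆ e∈)
  within-t : ∀ {w} → (∀ {e} → e ∈ w → e ∈ word t q∈) → ∀ {e} → e ∈ w → ∀ {u v} → Joins e u v → u ∈ τ × v ∈ τ
  within-t w⊆ e∈ = word-joins-within t q∈ (w⊆ e∈)
  bridge-joins : ∀ {u v} → Joins e u v → Joins (a , b) u v
  bridge-joins k with joins-unique ab k
  ... | inj₁ (refl , refl) = inj₁ refl
  ... | inj₂ (refl , refl) = inj₂ refl
  from-split : Split x f y (word s p∈) e (word t q∈) → NodeEdge s t a∈ b∈ u v
  from-split (same refl refl refl) with joins-unique ab j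
  ... | inj₁ (refl , refl) = forward (conn-within (within-s (λ p → p)) (conn-sym uc) a∈)
                                     (conn-within (within-t (λ p → p)) dv b∈)
  -- Here the bridge is crossed from `b` to `a`. Letters before it avoid `b` and letters after it
  -- avoid `a`, so both walks are empty.
  ... | inj₂ (refl , refl) = back
    (conn-outside (within-s (λ p → p)) (λ b∈σ → disjoint b∈σ b∈) (conn-sym uc))
    (conn-outside (within-t (λ p → p)) (disjoint a∈) dv)
  -- The first walk stays in `σ`. The second may cross into `τ`, but if it ends in `σ`, then
  -- `bridge` shortens it to the letters in `m`.
  from-split (before m w≡ refl) = case ∈-++⁻ σ v∈ of λ where
      (inj₁ v∈σ) → left (arc⇒edge s p∈ (++-uniqueˡ σ uniq)
        (x , f , m , w≡ , c , d , j , uc , proj₁ (bridge disjoint a∈ b∈ pieces dv v∈σ) d∈))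
      (inj₂ v∈τ) → forward u∈ v∈τ
    where
    m⊆ : ∀ {e} → e ∈ m → e ∈ word s p∈
    m⊆ k = subst (_ ∈_) (sym w≡) (∈-++⁺ʳ x (there k))
    x⊆ : ∀ {e} → e ∈ x → e ∈ word s p∈
    x⊆ k = subst (_ ∈_) (sym w≡) (∈-++⁺ˡ k)
    cd∈ = word-joins-within s p∈ (subst (f ∈_) (sym w≡) (∈-++⁺ʳ x (here refl))) j
    d∈ = proj₂ cd∈
    u∈ = conn-within (within-s x⊆) (conn-sym uc) (proj₁ cd∈)
    v∈ = conn-within (λ k∈ → word-joins-within (node s t a∈ b∈) r∈
           (subst (_ ∈_) (sym eq) (∈-++⁺ʳ x (there k∈)))) dv (∈-++⁺ˡ d∈)
    pieces : ∀ {k} → k ∈ m ++ e ∷ word t q∈ → ∀ {u v} → Joins k u v →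
      k ∈ m × u ∈ σ × v ∈ σ ⊎ Joins (a , b) u v ⊎ u ∈ τ × v ∈ τ
    pieces k∈ k with ∈-++⁻ m k∈
    ... | inj₁ k∈m = inj₁ (k∈m , within-s m⊆ k∈m k)
    ... | inj₂ (here refl) = inj₂ (inj₁ (bridge-joins k))
    ... | inj₂ (there k∈t) = inj₂ (inj₂ (word-joins-within t q∈ k∈t k))
  -- The mirror image: the first walk is reversed so that `bridge` applies with the parts exchanged.
  from-split (after m refl w≡) = case ∈-++⁻ σ u∈ of λ where
      (inj₂ u∈τ) → right (arc⇒edge t q∈ (++-uniqueʳ σ uniq)
        (m , f , y , w≡ , c , d , j , conn-sym (proj₁ (bridge (λ p q → disjoint q p) b∈ a∈ pieces (conn-sym uc) u∈τ) c∈) , dv))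
      (inj₁ u∈σ) → forward u∈σ v∈
    where
    m⊆ : ∀ {e} → e ∈ m → e ∈ word t q∈
    m⊆ k = subst (_ ∈_) (sym w≡) (∈-++⁺ˡ k)
    y⊆ : ∀ {e} → e ∈ y → e ∈ word t q∈
    y⊆ k = subst (_ ∈_) (sym w≡) (∈-++⁺ʳ m (there k))
    cd∈ = word-joins-within t q∈ (subst (f ∈_) (sym w≡) (∈-++⁺ʳ m (here refl))) j
    c∈ = proj₁ cd∈
    v∈ = conn-within (within-t y⊆) dv (proj₂ cd∈)
    u∈ = conn-within (λ k∈ → word-joins-within (node s t a∈ b∈) r∈
           (subst (_ ∈_) (sym eq) (∈-++⁺ˡ k∈))) (conn-sym uc) (∈-++⁺ʳ σ c∈)
    pieces : ∀ {k} → k ∈ word s p∈ ++ e ∷ m → ∀ {u v} → Joins k u v →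
      k ∈ m × u ∈ τ × v ∈ τ ⊎ Joins (b , a) u v ⊎ u ∈ σ × v ∈ σ
    pieces k∈ k with ∈-++⁻ (word s p∈) k∈
    ... | inj₁ k∈s = inj₂ (inj₂ (word-joins-within s p∈ k∈s k))
    ... | inj₂ (here refl) with bridge-joins k
    ... | inj₁ refl = inj₂ (inj₁ (inj₂ refl))
    ... | inj₂ refl = inj₂ (inj₁ (inj₁ refl))
    pieces k∈ k | inj₂ (there k∈m) = inj₁ (k∈m , within-t m⊆ k∈m k)

-- Every vertex except the root is the child of exactly one letter. So a word amounts to an ordering
-- of these vertices with a parent for each, which is what gets counted.
word-children : ∀ {σ r} (t : Tree {V} σ) (r∈ : r ∈ σ) → r ∷ map proj₁ (word t r∈) ↭ σ
word-children (leaf _) (here refl) = ↭-refl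
word-children (node {σ} {τ} {a} {b} s t a∈ b∈) r∈ with ∈-++⁻ σ r∈
... | inj₁ r∈σ rewrite map-++ proj₁ (word s r∈σ) ((b , a) ∷ word t b∈) =
  ++⁺ (word-children s r∈σ) (word-children t b∈)
... | inj₂ r∈τ rewrite map-++ proj₁ (word s a∈) ((a , b) ∷ word t r∈τ) =
  -- The child of the bridge is `a`, the root of the left part: it moves to the front of that block,
  -- and `r` to the front of the right block.
  ↭-trans (prep _ (shift a (map proj₁ (word s a∈)) _))
    (↭-trans (↭-sym (shift _ (a ∷ map proj₁ (word s a∈)) _)) (++⁺ (word-children s a∈) (word-children t r∈τ)))

word-loopless : ∀ {σ r} (t : Tree {V} σ) (r∈ : r ∈ σ) → Unique σ → All (λ (c , p) → c ≢ p) (word t r∈)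
word-loopless (leaf _) _ _ = []
word-loopless (node {σ} s t a∈ b∈) r∈ u with ∈-++⁻ σ r∈
... | inj₁ r∈σ = All.++⁺ (word-loopless s r∈σ (++-uniqueˡ σ u))
  ((λ { refl → ++-disjoint u a∈ b∈ }) ∷ word-loopless t b∈ (++-uniqueʳ σ u))
... | inj₂ r∈τ = All.++⁺ (word-loopless s a∈ (++-uniqueˡ σ u))
  ((λ { refl → ++-disjoint u a∈ b∈ }) ∷ word-loopless t r∈τ (++-uniqueʳ σ u))

-- Subsets of B(n) given by lists

_≟E_ : DecidableEquality (Fin n × Fin n)
_≟E_ = Product.≡-dec _≟_ _≟_

_≟B_ : DecidableEquality (B n)
_≟B_ = Maybe.≡-dec _≟E_

decode : Fin (suc (n * n)) → B n
decode zero = nothing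
decode {n} (suc k) = just (remQuot n k)

decode-enc : (x : B n) → decode (enc x) ≡ x
decode-enc nothing = refl
decode-enc (just (i , j)) = cong just (remQuot-combine i j)

enc-decode : (k : Fin (suc (n * n))) → enc (decode {n} k) ≡ k
enc-decode zero = refl
enc-decode {n} (suc k) = cong suc (combine-remQuot {n} n k)

enc-injective : {x y : B n} → enc x ≡ enc y → x ≡ y
enc-injective {x = x} {y} eq = trans (sym (decode-enc x)) (trans (cong decode eq) (decode-enc y))

_∈L?_ : ∀ (x : B n) xs → Dec (x ∈ xs)
_∈L?_ = _∈?_
  where open import Data.List.Membership.DecPropositional _≟B_ using (_∈?_)

member : List (B n) → Fin (suc (n * n)) → Bool
member xs k = does (decode k ∈L? xs)

fromList : List (B n) → SubB n
fromList xs = Vec.tabulate (member xs)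

∈-fromList⁺ : ∀ {x : B n} xs → x ∈ xs → x ∈B fromList xs
∈-fromList⁺ {x = x} xs x∈ = lookup⇒[]= (enc x) _ (trans (lookup∘tabulate (member xs) (enc x))
  (dec-true (decode (enc x) ∈L? xs) (subst (_∈ xs) (sym (decode-enc x)) x∈)))

∈-fromList⁻ : ∀ {x : B n} xs → x ∈B fromList xs → x ∈ xs
∈-fromList⁻ {x = x} xs x∈ = witness (decode (enc x) ∈L? xs)
  (trans (sym (lookup∘tabulate (member xs) (enc x))) ([]=⇒lookup x∈))
  where
  witness : (d : Dec (decode (enc x) ∈ xs)) → does d ≡ true → x ∈ xs
  witness (yes p) _ = subst (_∈ xs) (decode-enc x) p

⊆B-intro : ∀ {X Y : SubB n} → (∀ {x : B n} → x ∈B X → x ∈B Y) → _⊆B_ {n} X Y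
⊆B-intro {n} {X} {Y} X⊆Y {k} k∈ = subst (λ k → Y Vec.[ k ]= inside) (enc-decode {n} k)
  (X⊆Y {decode k} (subst (λ k → X Vec.[ k ]= inside) (sym (enc-decode {n} k)) k∈))

-- Generated subsemigroups and strict chains

Gen-mono : ∀ {xs ys : List (B n)} → (∀ {x} → x ∈ xs → x ∈ ys) → ∀ {z} → Gen xs z → Gen ys z
Gen-mono xs⊆ys (base x∈) = base (xs⊆ys x∈)
Gen-mono xs⊆ys (mul g h) = mul (Gen-mono xs⊆ys g) (Gen-mono xs⊆ys h)

Gen-trans : ∀ {xs ys : List (B n)} → (∀ {x} → x ∈ xs → Gen ys x) → ∀ {z} → Gen xs z → Gen ys z
Gen-trans xs⊆ys (base x∈) = xs⊆ys x∈
Gen-trans xs⊆ys (mul g h) = mul (Gen-trans xs⊆ys g) (Gen-trans xs⊆ys h)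

Gen-[] : ∀ {z : B n} → ¬ Gen [] z
Gen-[] (mul g _) = Gen-[] g

-- StrictChain for the reversed list: the newest element comes first.
data Strict {n} : List (B n) → Set where
  [] : Strict []
  _∷_ : ∀ {x xs} → ¬ Gen xs x → Strict xs → Strict (x ∷ xs)

strict⇒unique : ∀ {xs : List (B n)} → Strict xs → Unique xs
strict⇒unique [] = []
strict⇒unique {xs = _ ∷ xs} (¬g ∷ s) = ¬Any⇒All¬ xs (¬g ∘ base) ∷ strict⇒unique s

take-++ˡ : ∀ i (xs : List A) {ys} → i ≤ length xs → take i (xs ++ ys) ≡ take i xs
take-++ˡ zero _ _ = refl
take-++ˡ (suc i) (x ∷ xs) (s≤s le) = cong (x ∷_) (take-++ˡ i xs le)

take-length-++ : ∀ (xs : List A) {ys} → take (length xs) (xs ++ ys) ≡ xs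
take-length-++ xs = trans (take-++ˡ (length xs) xs ≤-refl) (take-all (length xs) xs ≤-refl)

length-∷ʳ : ∀ (xs : List A) x → length (xs ∷ʳ x) ≡ suc (length xs)
length-∷ʳ xs x = trans (length-++ xs) (+-comm (length xs) 1)

strictChain-∷ʳ⁺ : ∀ {xs : List (B n)} {x} → StrictChain xs → ¬ Gen xs x → StrictChain (xs ∷ʳ x)
strictChain-∷ʳ⁺ {xs = xs} {x} chain ¬g i i< with m≤n⇒m<n∨m≡n (subst (suc i ≤_) (length-∷ʳ xs x) i<)
... | inj₁ (s≤s i<′) rewrite take-++ˡ (suc i) xs {[ x ]} i<′ | take-++ˡ i xs {[ x ]} (≤-trans (n≤1+n i) i<′) = chain i i<′
... | inj₂ refl =
  x , base (subst (x ∈_) (sym (take-all _ (xs ∷ʳ x) (≤-reflexive (length-∷ʳ xs x)))) (∈-++⁺ʳ xs (here refl))) ,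
  subst (λ ys → ¬ Gen ys x) (sym (take-length-++ xs)) ¬g

strictChain-∷ʳ⁻ : ∀ {xs : List (B n)} {x} → StrictChain (xs ∷ʳ x) → StrictChain xs × ¬ Gen xs x
strictChain-∷ʳ⁻ {xs = xs} {x} chain = init , last
  where
  init : StrictChain xs
  init i i< with c ← chain i (≤-trans i< (≤-trans (n≤1+n _) (≤-reflexive (sym (length-∷ʳ xs x)))))
    rewrite take-++ˡ (suc i) xs {[ x ]} i< | take-++ˡ i xs {[ x ]} (≤-trans (n≤1+n i) i<) = c
  last : ¬ Gen xs x
  last g with chain (length xs) (≤-reflexive (sym (length-∷ʳ xs x)))
  ... | z , gz , ¬gz rewrite take-length-++ xs {[ x ]} | take-all _ (xs ∷ʳ x) (≤-reflexive (length-∷ʳ xs x)) =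
    -- If `xs` generated `x`, adding `x` would not enlarge the subsemigroup.
    ¬gz (Gen-trans (λ y∈ → absorb (∈-++⁻ xs y∈)) gz)
    where
    absorb : ∀ {y} → y ∈ xs ⊎ y ∈ [ x ] → Gen xs y
    absorb (inj₁ y∈) = base y∈
    absorb (inj₂ (here refl)) = g

strict⇒chain : ∀ {xs : List (B n)} → Strict xs → StrictChain (reverse xs)
strict⇒chain [] _ ()
strict⇒chain {xs = x ∷ xs} (¬g ∷ s) rewrite unfold-reverse x xs =
  strictChain-∷ʳ⁺ (strict⇒chain s) (¬g ∘ Gen-mono Any.reverse⁻)

chain⇒strict : ∀ (xs : List (B n)) → StrictChain (reverse xs) → Strict xs
chain⇒strict [] _ = []
chain⇒strict (x ∷ xs) chain rewrite unfold-reverse x xs =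
  let init , last = strictChain-∷ʳ⁻ chain in last ∘ Gen-mono Any.reverse⁺ ∷ chain⇒strict xs init

strict⇒face : ∀ {xs : List (B n)} → Strict xs → IsFace {n} (fromList xs)
strict⇒face {xs = xs} s = reverse xs ,
  Unique-resp-↭ (↭⇒↭ₛ (↭-sym (↭-reverse xs))) (strict⇒unique s) ,
  (λ x → mk⇔ (Any.reverse⁺ ∘ ∈-fromList⁻ {x = x} xs) (∈-fromList⁺ xs ∘ Any.reverse⁻)) ,
  strict⇒chain s
  where open import Data.List.Relation.Binary.Permutation.Setoid.Properties (setoid _) using (Unique-resp-↭)

face⇒strict : ∀ {X : SubB n} → IsFace {n} X → ∃ λ xs → Strict xs × (∀ {x : B n} → x ∈B X → x ∈ xs)
face⇒strict (xs , _ , X⇔xs , chain) = reverse xs ,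
  chain⇒strict (reverse xs) (subst StrictChain (sym (reverse-involutive xs)) chain) ,
  λ {x} x∈ → Any.reverse⁺ (Equivalence.to (X⇔xs x) x∈)

-- From strict chains to valid sequences and back

On : (Fin n → Fin n → Set) → B n → Set
On R nothing = ⊤
On R (just (i , j)) = R i j

module _ {n} {R : Fin n → Fin n → Set} (R-trans : ∀ {i j k} → R i j → R j k → R i k) where
  on-· : ∀ a b → On R a → On R b → On R (a · b)
  on-· nothing _ _ _ = _
  on-· (just _) nothing _ _ = _
  on-· (just (i , j)) (just (k , l)) r s with j ≟ k
  ... | yes refl = R-trans r s
  ... | no _ = _

  -- The pairs in a transitive relation form a subsemigroup together with 0. This is the tool for
  -- showing that an element is not generated.
  Gen-on : ∀ {xs} → (∀ {x} → x ∈ xs → On R x) → ∀ {z} → Gen xs z → On R z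
  Gen-on on (base x∈) = on x∈
  Gen-on on (mul {a} {b} g h) = on-· a b (Gen-on on g) (Gen-on on h)

·-just : ∀ (i j k : Fin n) → just (i , j) · just (j , k) ≡ just (i , k)
·-just i j k with j ≟ j
... | yes _ = refl
... | no j≢j = contradiction refl j≢j

-- The edges along a nonempty walk multiply to the pair of its ends. The first alternative is the
-- empty walk, whose loop need not be generated.
reach⇒gen : ∀ {es xs} → (∀ {e : Fin n × Fin n} → e ∈ es → just e ∈ xs) →
  ∀ {i j} → Reach es i j → i ≡ j ⊎ Gen xs (just (i , j))
reach⇒gen es⊆xs ε = inj₁ refl
reach⇒gen es⊆xs (e ◅ r) with reach⇒gen es⊆xs r
... | inj₁ refl = inj₂ (base (es⊆xs e))
... | inj₂ g = inj₂ (subst (Gen _) (·-just _ _ _) (mul (base (es⊆xs e)) g))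

-- Only 0 and the loops are dropped. A new edge joined by a walk of older edges would be their
-- product, contradicting strictness.
strict⇒valid : ∀ {xs : List (B n)} → Strict xs → ∃ λ es → Valid es ×
  (∀ {e} → e ∈ es → just e ∈ xs) × (∀ {i j} → i ≢ j → just (i , j) ∈ xs → (i , j) ∈ es)
strict⇒valid [] = [] , [] , (λ ()) , λ _ ()
strict⇒valid (_∷_ {nothing} _ s) with es , val , es⊆ , ⊆es ← strict⇒valid s =
  es , val , there ∘ es⊆ , λ { i≢j (there p) → ⊆es i≢j p }
strict⇒valid (_∷_ {just (i , j)} ¬g s) with es , val , es⊆ , ⊆es ← strict⇒valid s with i ≟ j
... | yes i≡j = es , val , there ∘ es⊆ , λ { i≢j (here refl) → contradiction i≡j i≢j ; i≢j (there p) → ⊆es i≢j p }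
... | no i≢j = (i , j) ∷ es , (λ r → absurd (reach⇒gen es⊆ r)) ∷ val ,
    (λ { (here refl) → here refl ; (there p) → there (es⊆ p) }) ,
    λ { _ (here refl) → here refl ; i≢j (there p) → there (⊆es i≢j p) }
  where
  absurd : ¬ (i ≡ j ⊎ Gen _ (just (i , j)))
  absurd (inj₁ i≡j) = i≢j i≡j
  absurd (inj₂ g) = ¬g g

diag : Fin n → B n
diag v = just (v , v)

-- Newest first again: the chain starts with 0, continues with the loops and ends with the edges.
elements : ∀ {σ : List (Fin n)} → Tree σ → List (B n)
elements {σ = σ} t = map just (edges t) ++ map diag σ ++ [ nothing ]

data Element {n} {σ : List (Fin n)} (t : Tree σ) : B n → Set where
  edge : ∀ {e} → e ∈ edges t → Element t (just e)
  loop : ∀ {v} → v ∈ σ → Element t (diag v)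
  zero : Element t nothing

module _ {σ : List (Fin n)} (t : Tree σ) where
  element⁺ : ∀ {x} → Element t x → x ∈ elements t
  element⁺ (edge e∈) = ∈-++⁺ˡ (∈-map⁺ just e∈)
  element⁺ (loop v∈) = ∈-++⁺ʳ (map just (edges t)) (∈-++⁺ˡ (∈-map⁺ _ v∈))
  element⁺ zero = ∈-++⁺ʳ (map just (edges t)) (∈-++⁺ʳ (map diag σ) (here refl))

  element⁻ : ∀ {x} → x ∈ elements t → Element t x
  element⁻ x∈ with ∈-++⁻ (map just (edges t)) x∈
  ... | inj₁ p with _ , e∈ , refl ← ∈-map⁻ just p = edge e∈
  ... | inj₂ p with ∈-++⁻ (map diag σ) p
  ... | inj₁ q with _ , v∈ , refl ← ∈-map⁻ diag q = loop v∈
  element⁻ x∈ | inj₂ p | inj₂ (here refl) = zero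

strict-loops : ∀ {vs : List (Fin n)} → Unique vs → Strict (map diag vs ++ [ nothing ])
strict-loops [] = Gen-[] ∷ []
strict-loops {vs = v ∷ vs} (v∉ ∷ u) =
  (λ g → All.lookup v∉ (proj₂ (Gen-on {R = λ i j → i ≡ j × i ∈ vs} (λ { (refl , i∈) (refl , _) → refl , i∈ }) on g)) refl)
  ∷ strict-loops u
  where
  on : ∀ {x} → x ∈ map diag vs ++ [ nothing ] → On (λ i j → i ≡ j × i ∈ vs) x
  on x∈ with ∈-++⁻ (map diag vs) x∈
  ... | inj₁ p with _ , v∈ , refl ← ∈-map⁻ diag p = refl , v∈
  on x∈ | inj₂ (here refl) = _

-- Reachability by the older edges is transitive and contains these edges and all loops, but not the
-- new edge; `Gen-on` applies to it.
strict-elements : ∀ {σ : List (Fin n)} (t : Tree σ) → Unique σ → Strict (elements t)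
strict-elements {n} {σ} t u = strict-edges (valid-edges t u)
  where
  on : ∀ es {x} → x ∈ map just es ++ map diag σ ++ [ nothing ] → On (Reach es) x
  on es x∈ with ∈-++⁻ (map just es) x∈
  ... | inj₁ p with _ , e∈ , refl ← ∈-map⁻ just p = e∈ ◅ ε
  ... | inj₂ p with ∈-++⁻ (map diag σ) p
  ... | inj₁ q with _ , _ , refl ← ∈-map⁻ diag q = ε
  on es x∈ | inj₂ p | inj₂ (here refl) = _
  strict-edges : ∀ {es} → Valid es → Strict (map just es ++ map diag σ ++ [ nothing ])
  strict-edges [] = strict-loops u
  strict-edges {_ ∷ es} (¬r ∷ val) = (λ g → ¬r (Gen-on {R = Reach es} _◅◅_ (on es) g)) ∷ strict-edges val

-- Facets are exactly the tree sets

treeSet : ∀ {σ : List (Fin n)} → Tree σ → SubB n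
treeSet t = fromList (elements t)

treeSet-face : ∀ {σ : List (Fin n)} (t : Tree σ) → Unique σ → IsFace {n} (treeSet t)
treeSet-face t u = strict⇒face (strict-elements t u)

unique-allFin-↭ : ∀ {σ} → σ ↭ allFin n → Unique σ
unique-allFin-↭ {n} σ↭ = Unique-resp-↭ (↭⇒↭ₛ (↭-sym σ↭)) (Unique.allFin⁺ n)
  where open import Data.List.Relation.Binary.Permutation.Setoid.Properties (setoid _) using (Unique-resp-↭)

module _ {σ : List (Fin n)} (t : Tree σ) (u : Unique σ) where
  edges-irreflexive : ∀ {i j} → (i , j) ∈ edges t → i ≢ j
  edges-irreflexive = valid-irreflexive (valid-edges t u)

  edge⁻ : ∀ {i j} → i ≢ j → just (i , j) ∈ elements t → (i , j) ∈ edges t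
  edge⁻ i≢j x∈ with element⁻ t x∈
  ... | edge e∈ = e∈
  ... | loop _ = contradiction refl i≢j

treeSet-mono : ∀ {σ τ : List (Fin n)} (s : Tree σ) (t : Tree τ) → τ ↭ allFin n →
  (∀ {e} → e ∈ edges s → e ∈ edges t) → _⊆B_ {n} (treeSet s) (treeSet t)
treeSet-mono s t τ↭ s⊆t = ⊆B-intro {X = treeSet s} {treeSet t} λ {x} x∈ →
  ∈-fromList⁺ (elements t) (element x (element⁻ s (∈-fromList⁻ (elements s) x∈)))
  where
  element : ∀ x → Element s x → x ∈ elements t
  element _ zero = element⁺ t zero
  element _ (loop {v} _) = element⁺ t (loop (∈-resp-↭ (↭-sym τ↭) (∈-allFin v)))
  element _ (edge e∈) = element⁺ t (edge (s⊆t e∈))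

edges-mono : ∀ {σ τ : List (Fin n)} (s : Tree σ) (t : Tree τ) → Unique σ → Unique τ →
  _⊆B_ {n} (treeSet s) (treeSet t) → ∀ {e} → e ∈ edges s → e ∈ edges t
edges-mono s t σ! τ! s⊆t e∈ = edge⁻ t τ! (edges-irreflexive s σ! e∈)
  (∈-fromList⁻ (elements t) (s⊆t (∈-fromList⁺ (elements s) (element⁺ s (edge e∈)))))

-- The elements of a face other than 0 and loops lie in a valid sequence, which some tree covers; 0
-- and the loops lie in every tree set on all vertices.
face⊆treeSet : ∀ {Y : SubB (suc n)} → IsFace {suc n} Y →
  ∃₂ λ σ (t : Tree σ) → σ ↭ allFin (suc n) × _⊆B_ {suc n} Y (treeSet t)
face⊆treeSet {n} {Y} face
  with xs , strict , Y⊆xs ← face⇒strict {X = Y} face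
  with es , val , _ , ⊆es ← strict⇒valid strict
  with σ , t , σ↭ , covers ← covering-tree _≟_ _ (allFin (suc n)) ≤-refl (Unique.allFin⁺ (suc n)) (zero , here refl) val =
  σ , t , σ↭ , ⊆B-intro {X = Y} {treeSet t} λ {x} x∈ → ∈-fromList⁺ (elements t) (element⁺ t (element x (Y⊆xs {x} x∈)))
  where
  element : ∀ x → x ∈ xs → Element t x
  element nothing _ = zero
  element (just (i , j)) x∈ with i ≟ j
  ... | yes refl = loop (∈-resp-↭ (↭-sym σ↭) (∈-allFin i))
  ... | no i≢j = edge (covers (⊆es i≢j x∈) (∈-allFin i) (∈-allFin j))

-- All trees on the same vertices have equally many edges, so a tree set contained in another one equals it.
treeSet-facet : ∀ {σ} (t : Tree σ) → σ ↭ allFin (suc n) → IsFacet {suc n} (treeSet t)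
treeSet-facet {n} {σ} t σ↭ = treeSet-face t σ! , maximal
  where
  σ! = unique-allFin-↭ σ↭
  maximal : ∀ Y → IsFace {suc n} Y → _⊆B_ {suc n} (treeSet t) Y → _⊆B_ {suc n} Y (treeSet t)
  maximal Y face t⊆Y with τ , s , τ↭ , Y⊆s ← face⊆treeSet {Y = Y} face = λ x∈ →
    treeSet-mono s t σ↭
      (unique-⊆-antisym _≟E_ (valid⇒unique (valid-edges t σ!))
        (edges-mono t s σ! (unique-allFin-↭ τ↭) (λ y∈ → Y⊆s (t⊆Y y∈)))
        (≤-reflexive (length-edges-cong s t (trans (↭-length τ↭) (sym (↭-length σ↭))))))
      (Y⊆s x∈)

facet⇒treeSet : ∀ {X : SubB (suc n)} → IsFacet {suc n} X →
  ∃₂ λ σ (t : Tree σ) → σ ↭ allFin (suc n) × X ≡ treeSet t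
facet⇒treeSet {n} {X} (face , maximal) with σ , t , σ↭ , X⊆t ← face⊆treeSet {Y = X} face =
  σ , t , σ↭ , ⊆-antisym X⊆t (maximal (treeSet t) (proj₁ (treeSet-facet t σ↭)) X⊆t)

-- Deciding and listing the facets

module _ {n} (xs : List (B n)) where
  candidates : List (B n) → List (B n)
  candidates acc = xs ++ cartesianProductWith _·_ acc acc

  Closed : List (B n) → Set
  Closed acc = ∀ {z} → z ∈ candidates acc → z ∈ acc

  -- Since acc has no repetitions, it outgrows B n before the fuel k runs out.
  saturate : ∀ k acc → Unique acc → (∀ {z} → z ∈ acc → Gen xs z) → suc (n * n) < k + length acc →
    ∃ λ acc → (∀ {z} → z ∈ acc → Gen xs z) × Closed acc
  saturate zero acc u _ len = contradiction (unique-length-≤ u (λ {x} _ → enc x) λ _ _ → enc-injective) (<⇒≱ len)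
  saturate (suc k) acc u sound len with any? (λ z → ¬? (z ∈L? acc)) (candidates acc)
  ... | no none = acc , sound , λ {z} z∈ → decidable-stable (z ∈L? acc) λ z∉ → none (lose z∈ z∉)
  ... | yes some with z , z∈ , z∉ ← find some =
    saturate k (z ∷ acc) (¬Any⇒All¬ acc z∉ ∷ u) (λ { (here refl) → new (∈-++⁻ xs z∈) ; (there p) → sound p })
      (subst (suc (n * n) <_) (sym (+-suc k (length acc))) len)
    where
    new : ∀ {z} → z ∈ xs ⊎ z ∈ cartesianProductWith _·_ acc acc → Gen xs z
    new (inj₁ z∈) = base z∈
    new (inj₂ z∈) with _ , _ , a∈ , b∈ , refl ← ∈-cartesianProductWith⁻ _·_ acc acc z∈ = mul (sound a∈) (sound b∈)

  gen? : ∀ z → Dec (Gen xs z)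
  -- The fuel is one more than the number of elements of B(n).
  gen? z with acc , sound , closed ← saturate (suc (suc (n * n))) [] [] (λ ()) (≤-reflexive (sym (+-identityʳ _))) =
    map′ sound (complete closed) (z ∈L? acc)
    where
    complete : ∀ {acc} → Closed acc → ∀ {z} → Gen xs z → z ∈ acc
    complete closed (base z∈) = closed (∈-++⁺ˡ z∈)
    complete closed (mul g h) = closed (∈-++⁺ʳ xs (∈-cartesianProductWith⁺ _·_ (complete closed g) (complete closed h)))

anyB? : ∀ {P : B n → Set} → Decidable P → Dec (∃ P)
anyB? {P = P} P? = map′ (λ (k , p) → decode k , p) (λ (x , p) → enc x , subst P (sym (decode-enc x)) p)
  (Fin.any? (P? ∘ decode))

allB? : ∀ {P : B n → Set} → Decidable P → Dec (∀ x → P x)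
allB? {P = P} P? = map′ (λ p x → subst P (decode-enc x) (p (enc x))) (λ p k → p (decode k)) (Fin.all? (P? ∘ decode))

anyList? : ∀ k {P : List (B n) → Set} → Decidable P → Dec (∃ λ xs → length xs ≤ k × P xs)
anyList? zero P? = map′ (λ p → [] , z≤n , p) (λ { ([] , _ , p) → p }) (P? [])
anyList? (suc k) {P} P? =
  map′ (λ { (inj₁ p) → [] , z≤n , p ; (inj₂ (x , xs , len , p)) → x ∷ xs , s≤s len , p })
       (λ { ([] , _ , p) → inj₁ p ; (x ∷ xs , s≤s len , p) → inj₂ (x , xs , len , p) })
       (P? [] ⊎-dec anyB? λ x → anyList? k (P? ∘ (x ∷_)))

strictChain? : (xs : List (B n)) → Dec (StrictChain xs)
strictChain? xs = map′ (λ p i i< → p i<) (λ p {i} → p i)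
  (allUpTo? (λ i → anyB? λ z → gen? (take (suc i) xs) z ×-dec ¬? (gen? (take i xs) z)) (length xs))

isFace? : (X : SubB n) → Dec (IsFace {n} X)
isFace? {n} X = map′ (λ (xs , _ , p) → xs , p) (λ (xs , p) → xs , bound p , p)
  -- An enumeration has no repetitions, so its length is at most the size of B(n) and the search is
  -- finite.
  (anyList? (suc (n * n)) λ xs → unique? xs ×-dec
    (allB? λ x → (enc x Subset.∈? X) ⇔-dec (x ∈L? xs)) ×-dec strictChain? xs)
  where
  open import Data.List.Relation.Unary.Unique.DecPropositional _≟B_ using (unique?)
  bound : ∀ {xs P} → Unique xs × P → length xs ≤ suc (n * n)
  bound (u , _) = unique-length-≤ u (λ {x} _ → enc x) λ _ _ → enc-injective
  _⇔-dec_ : ∀ {P Q : Set} → Dec P → Dec Q → Dec (P ⇔ Q)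
  P? ⇔-dec Q? = map′ (λ (f , g) → mk⇔ f g) (λ e → Equivalence.to e , Equivalence.from e)
    ((P? →-dec Q?) ×-dec (Q? →-dec P?))

isFacet? : (X : SubB n) → Dec (IsFacet {n} X)
isFacet? {n} X = isFace? {n} X ×-dec map′ to from (¬? (Subset.anySubset? larger?))
  where
  Larger : SubB n → Set
  Larger Y = IsFace {n} Y × _⊆B_ {n} X Y × ¬ _⊆B_ {n} Y X
  larger? : ∀ Y → Dec (Larger Y)
  larger? Y = isFace? {n} Y ×-dec X Subset.⊆? Y ×-dec ¬? (Y Subset.⊆? X)
  to : ¬ ∃ Larger → ∀ Y → IsFace {n} Y → _⊆B_ {n} X Y → _⊆B_ {n} Y X
  to none Y face X⊆Y = decidable-stable (Y Subset.⊆? X) λ Y⊈X → none (Y , face , X⊆Y , Y⊈X)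
  from : (∀ Y → IsFace {n} Y → _⊆B_ {n} X Y → _⊆B_ {n} Y X) → ¬ ∃ Larger
  from maximal (Y , face , X⊆Y , Y⊈X) = Y⊈X (maximal Y face X⊆Y)

subsets : ∀ k → List (Subset k)
subsets zero = [ [] ]
subsets (suc k) = map (inside ∷_) (subsets k) ++ map (outside ∷_) (subsets k)

∈-subsets : ∀ {k} (p : Subset k) → p ∈ subsets k
∈-subsets [] = here refl
∈-subsets (inside ∷ p) = ∈-++⁺ˡ (∈-map⁺ _ (∈-subsets p))
∈-subsets {suc k} (outside ∷ p) = ∈-++⁺ʳ (map (inside ∷_) (subsets k)) (∈-map⁺ _ (∈-subsets p))

subsets-unique : ∀ k → Unique (subsets k)
subsets-unique zero = [] ∷ []
subsets-unique (suc k) = Unique.++⁺ (Unique.map⁺ ∷-injectiveʳ (subsets-unique k)) (Unique.map⁺ ∷-injectiveʳ (subsets-unique k)) disjoint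
  where
  disjoint : ∀ {p} → ¬ (p ∈ map (inside ∷_) (subsets k) × p ∈ map (outside ∷_) (subsets k))
  disjoint (p∈ , q∈) with _ , _ , refl ← ∈-map⁻ (inside ∷_) p∈ with _ , _ , () ← ∈-map⁻ (outside ∷_) q∈

facets : ∀ n → List (SubB n)
facets n = filter (isFacet? {n}) (subsets (suc (n * n)))

facets-unique : ∀ n → Unique (facets n)
facets-unique n = Unique.filter⁺ (isFacet? {n}) (subsets-unique (suc (n * n)))

∈-facets⁺ : ∀ n {X : SubB n} → IsFacet {n} X → X ∈ facets n
∈-facets⁺ n {X} = ∈-filter⁺ (isFacet? {n}) (∈-subsets X)

∈-facets⁻ : ∀ n {X : SubB n} → X ∈ facets n → IsFacet {n} X
∈-facets⁻ n X∈ = proj₂ (∈-filter⁻ (isFacet? {n}) {xs = subsets (suc (n * n))} X∈)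

facetCount : ∀ n → FacetCount n (length (facets n))
facetCount n = facets n , facets-unique n , (λ X → mk⇔ (∈-facets⁻ n) (∈-facets⁺ n)) , refl

-- Codes with two digits per level

-- Mixed-radix numerals serving both bounds: at each level the first digit picks a vertex and the
-- second a partner for it.
Code : (a b : ℕ → ℕ) → ℕ → Set
Code a b zero = ⊤
Code a b (suc k) = Fin (a k) × Fin (b k) × Code a b k

size : (a b : ℕ → ℕ) → ℕ → ℕ
size a b zero = 1
size a b (suc k) = a k * (b k * size a b k)

code↔ : ∀ {a b} k → Code a b k ↔ Fin (size a b k)
code↔ zero = ↔-sym 1↔⊤
code↔ {a} {b} (suc k) =
  ↔-trans (↔-refl ×-↔ ↔-trans (↔-refl ×-↔ code↔ k) (↔-sym *↔×)) (↔-sym *↔×)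

to-injective : ∀ {A B : Set} (f : A ↔ B) {x y} → Inverse.to f x ≡ Inverse.to f y → x ≡ y
to-injective f = Injection.injective (↔⇒↣ f)

from-injective : ∀ {A B : Set} (f : A ↔ B) {x y} → Inverse.from f x ≡ Inverse.from f y → x ≡ y
from-injective f = to-injective (↔-sym f)

-- Upper bound: coding facets by words

tabulate-punchIn : ∀ {k} (ι : Fin (suc k) → V) i → tabulate ι ↭ ι i ∷ tabulate (ι ∘ punchIn i)
tabulate-punchIn ι zero = ↭-refl
tabulate-punchIn {k = suc k} ι (suc i) = ↭-trans (prep (ι zero) (tabulate-punchIn (ι ∘ suc) i)) (swap _ _ ↭-refl)

-- The next child is one of the `suc k` vertices still listed by `ι`, its parent any of the `m`
-- vertices different from it.
WordCode : ℕ → ℕ → Set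
WordCode m = Code suc (λ _ → m)

toWord : ∀ {m k} → (Fin k → Fin (suc m)) → WordCode m k → List (Fin (suc m) × Fin (suc m))
toWord {k = zero} ι _ = []
toWord {k = suc k} ι (i , p , c) = (ι i , punchIn (ι i) p) ∷ toWord (ι ∘ punchIn i) c

-- Codes may also describe words that come from no tree; for an upper bound it suffices that every
-- word of a tree is reached.
toWord-surjective : ∀ {m k} (ι : Fin k → Fin (suc m)) w → map proj₁ w ↭ tabulate ι →
  All (λ (c , p) → c ≢ p) w → ∃ λ c → toWord ι c ≡ w
toWord-surjective {k = zero} ι [] _ _ = _ , refl
toWord-surjective {k = zero} ι (_ ∷ _) perm _ = case ↭-length perm of λ ()
toWord-surjective {k = suc _} ι [] perm _ = case ↭-length perm of λ ()
toWord-surjective {k = suc _} ι ((_ , p) ∷ w) perm (c≢p ∷ loopless)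
  with i , refl ← ∈-tabulate⁻ {f = ι} (∈-resp-↭ perm (here refl))
  with c , eq ← toWord-surjective (ι ∘ punchIn i) w (drop-∷ (↭-trans perm (tabulate-punchIn ι i))) loopless =
  (i , punchOut c≢p , c) , cong₂ _∷_ (cong (ι i ,_) (punchIn-punchOut c≢p)) eq

-- A relation, because different trees can have the same tree set.
record Coded {m} (X : SubB (suc m)) (c : WordCode m m) : Set where
  constructor coded
  field
    {σ} : List (Fin (suc m))
    tree : Tree σ
    σ↭ : σ ↭ allFin (suc m)
    X≡ : X ≡ treeSet tree
    root∈ : zero ∈ σ
    word≡ : toWord suc c ≡ word tree root∈

facet-coded : ∀ {m} {X : SubB (suc m)} → IsFacet {suc m} X → ∃ (Coded {m} X)
facet-coded {m} {X} facet =
  let σ , t , σ↭ , X≡ = facet⇒treeSet {m} {X} facet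
      root∈ = ∈-resp-↭ (↭-sym σ↭) (here refl)
      c , word≡ = toWord-surjective suc (word t root∈) (drop-∷ (↭-trans (word-children t root∈) σ↭))
                    (word-loopless t root∈ (unique-allFin-↭ σ↭))
  in c , coded t σ↭ X≡ root∈ word≡

-- Edges of either tree are arcs of the common word, hence edges of the other tree.
coded-injective : ∀ {m} {X Y : SubB (suc m)} {c} → Coded {m} X c → Coded {m} Y c → X ≡ Y
coded-injective {m} (coded s σ↭ refl r∈ ws) (coded t τ↭ refl r∈′ wt) = ⊆-antisym
  (treeSet-mono s t τ↭ λ e∈ → arc⇒edge t r∈′ (unique-allFin-↭ τ↭)
    (subst (λ w → Arc w _ _) (trans (sym ws) wt) (edge⇒arc s r∈ e∈)))
  (treeSet-mono t s σ↭ λ e∈ → arc⇒edge s r∈ (unique-allFin-↭ σ↭)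
    (subst (λ w → Arc w _ _) (trans (sym wt) ws) (edge⇒arc t r∈′ e∈)))

facets-≤ : ∀ m → length (facets (suc m)) ≤ size suc (λ _ → m) m
facets-≤ m = unique-length-≤ (facets-unique (suc m)) (λ X∈ → Inverse.to (code↔ m) (proj₁ (code X∈)))
  λ {X} {Y} p q eq → coded-injective {m} (proj₂ (code p))
    (subst (Coded {m} Y) (sym (to-injective (code↔ m) eq)) (proj₂ (code q)))
  where
  code : ∀ {X} → X ∈ facets (suc m) → ∃ (Coded {m} X)
  code {X} X∈ = facet-coded {m} {X} (∈-facets⁻ (suc m) X∈)

-- Lower bound: splitting off single vertices

-- On `3 + k` vertices, the first digit picks the vertex split off and the second the source of the
-- back edge among the others. Two vertices offer no choice, as both orders give the same two edges;
-- hence the factor 1/2 in the count.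
ChainCode : ℕ → Set
ChainCode = Code (3 +_) (2 +_)

chainOrder : ∀ {k} → (Fin (2 + k) → V) → ChainCode k → List V
chainOrder {k = zero} ι _ = ι zero ∷ ι (suc zero) ∷ []
chainOrder {k = suc k} ι (v , _ , c) = ι v ∷ chainOrder (ι ∘ punchIn v) c

chainOrder-↭ : ∀ {k} (ι : Fin (2 + k) → V) c → chainOrder ι c ↭ tabulate ι
chainOrder-↭ {k = zero} ι _ = ↭-refl
chainOrder-↭ {k = suc k} ι (v , _ , c) =
  ↭-trans (prep (ι v) (chainOrder-↭ (ι ∘ punchIn v) c)) (↭-sym (tabulate-punchIn ι v))

∈-chainOrder : ∀ {k} (ι : Fin (2 + k) → V) c i → ι i ∈ chainOrder ι c
∈-chainOrder ι c i = ∈-resp-↭ (↭-sym (chainOrder-↭ ι c)) (∈-tabulate⁺ {f = ι} i)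

chain : ∀ {k} (ι : Fin (2 + k) → V) (c : ChainCode k) → Tree (chainOrder ι c)
chain {k = zero} ι _ = node (leaf (ι zero)) (leaf (ι (suc zero))) (here refl) (here refl)
chain {k = suc k} ι (v , p , c) =
  node (leaf (ι v)) (chain (ι ∘ punchIn v) c) (here refl) (∈-chainOrder (ι ∘ punchIn v) c p)

module _ {k} (ι : Fin (3 + k) → V) (v : Fin (3 + k)) (p : Fin (2 + k)) (c : ChainCode k) where
  ChainEdge : V → V → Set
  ChainEdge = NodeEdge (leaf (ι v)) (chain (ι ∘ punchIn v) c) (here refl) (∈-chainOrder (ι ∘ punchIn v) c p)

  chain-edge⁺ : ∀ {x y} → ChainEdge x y → (x , y) ∈ edges (chain ι (v , p , c))
  chain-edge⁺ = node-edge⁺ (leaf (ι v)) (chain (ι ∘ punchIn v) c) _ _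

  chain-edge⁻ : ∀ {x y} → (x , y) ∈ edges (chain ι (v , p , c)) → ChainEdge x y
  chain-edge⁻ = node-edge⁻ (leaf (ι v)) (chain (ι ∘ punchIn v) c) _ _

  edge-from-first : ∀ {w} → w ≢ v → (ι v , ι w) ∈ edges (chain ι (v , p , c))
  edge-from-first w≢v = chain-edge⁺ (forward (here refl)
    (subst (λ w → ι w ∈ chainOrder (ι ∘ punchIn v) c) (punchIn-punchOut (w≢v ∘ sym))
      (∈-chainOrder (ι ∘ punchIn v) c (punchOut (w≢v ∘ sym)))))

-- The back edge enters the first vertex, and the first vertex sends an edge to every other one.
chain-incoming : ∀ {k} (ι : Fin (2 + k) → V) c i → ∃ λ x → (x , ι i) ∈ edges (chain ι c)
chain-incoming {k = zero} ι _ zero = _ , here refl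
chain-incoming {k = zero} ι _ (suc zero) = _ , there (here refl)
chain-incoming {k = suc k} ι (v , p , c) i with i ≟ v
... | yes refl = _ , here refl
... | no i≢v = ι v , edge-from-first ι v p c i≢v

module _ {k} (ι : Fin (3 + k) → V) (ι-injective : ∀ {i j} → ι i ≡ ι j → i ≡ j) where
  first∉rest : ∀ v c → ι v ∉ chainOrder (ι ∘ punchIn v) c
  first∉rest v c v∈ with j , eq ← ∈-tabulate⁻ {f = ι ∘ punchIn v} (∈-resp-↭ (chainOrder-↭ (ι ∘ punchIn v) c) v∈) =
    punchInᵢ≢i v j (sym (ι-injective eq))

  -- Only the back edge enters the first vertex, so the edge set determines the second digit.
  edge-to-first : ∀ v p c {u} → (u , ι v) ∈ edges (chain ι (v , p , c)) → u ≡ ι (punchIn v p)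
  edge-to-first v p c e∈ with chain-edge⁻ ι v p c e∈
  ... | back u≡ _ = u≡
  ... | right e∈′ = contradiction (proj₂ (edges-within (chain (ι ∘ punchIn v) c) e∈′)) (first∉rest v c)
  ... | forward _ v∈ = contradiction v∈ (first∉rest v c)

  edge-in-rest : ∀ v p c {x y} → x ≢ ι v → y ≢ ι v → (x , y) ∈ edges (chain ι (v , p , c)) →
    (x , y) ∈ edges (chain (ι ∘ punchIn v) c)
  edge-in-rest v p c x≢ y≢ e∈ with chain-edge⁻ ι v p c e∈
  ... | back _ y≡ = contradiction y≡ y≢
  ... | right e∈′ = e∈′
  ... | forward (here x≡) _ = contradiction x≡ x≢

  -- In a chain with first vertices v ≠ w, the only edges into w would come from v;
  -- but w also has an incoming edge from the rest of the first chain.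
  same-first : ∀ {v p c w q d} →
    (∀ {e} → e ∈ edges (chain ι (v , p , c)) → e ∈ edges (chain ι (w , q , d))) → v ≡ w
  same-first {v} {p} {c} {w} {q} {d} sub with v ≟ w
  ... | yes v≡w = v≡w
  ... | no v≢w with x , e∈ ← chain-incoming (ι ∘ punchIn v) c (punchOut v≢w) =
    contradiction (subst (_∈ chainOrder (ι ∘ punchIn v) c) x≡v
      (proj₁ (edges-within (chain (ι ∘ punchIn v) c) e∈))) (first∉rest v c)
    where
    xw∈ : (x , ι w) ∈ edges (chain ι (v , p , c))
    xw∈ = chain-edge⁺ ι v p c (right (subst (λ j → (x , ι j) ∈ edges (chain (ι ∘ punchIn v) c)) (punchIn-punchOut v≢w) e∈))
    x≡v : x ≡ ι v
    x≡v = trans (edge-to-first w q d (sub xw∈)) (sym (edge-to-first w q d (sub (edge-from-first ι v p c (v≢w ∘ sym)))))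

  rest-⊆ : ∀ {v p c q d} → (∀ {e} → e ∈ edges (chain ι (v , p , c)) → e ∈ edges (chain ι (v , q , d))) →
    ∀ {e} → e ∈ edges (chain (ι ∘ punchIn v) c) → e ∈ edges (chain (ι ∘ punchIn v) d)
  rest-⊆ {v} {p} {c} {q} {d} sub e∈ = edge-in-rest v q d
    (λ { refl → first∉rest v c (proj₁ (edges-within (chain (ι ∘ punchIn v) c) e∈)) })
    (λ { refl → first∉rest v c (proj₂ (edges-within (chain (ι ∘ punchIn v) c) e∈)) })
    (sub (chain-edge⁺ ι v p c (right e∈)))

-- The edge set reveals the digits in turn: first the vertex split off, then the source of the only
-- edge into it; deleting that vertex leaves the edges of the remaining chain.
chain-injective : ∀ {k} (ι : Fin (2 + k) → V) → (∀ {i j} → ι i ≡ ι j → i ≡ j) → ∀ c d →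
  (∀ {e} → e ∈ edges (chain ι c) → e ∈ edges (chain ι d)) → c ≡ d
chain-injective {k = zero} _ _ _ _ _ = refl
chain-injective {k = suc k} ι ι-injective (v , p , c) (w , q , d) sub
  with refl ← same-first ι ι-injective {v} {p} {c} {w} {q} {d} sub
  with refl ← punchIn-injective v p q (ι-injective (edge-to-first ι ι-injective v q d (sub (here refl)))) =
  cong (λ c → v , p , c) (chain-injective (ι ∘ punchIn v) (punchIn-injective v _ _ ∘ ι-injective) c d
    (rest-⊆ ι ι-injective {v} {p} {c} {q} {d} sub))

facets-≥ : ∀ k → size (3 +_) (2 +_) k ≤ length (facets (2 + k))
facets-≥ k = injective⇒≤ {f = λ i → index (facet∈ (code i))} λ {i} {j} eq →
  from-injective (code↔ k) (chain-injective (λ v → v) (λ eq → eq) (code i) (code j)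
    (edges-mono (tree i) (tree j) (unique-allFin-↭ (chainOrder-↭ _ (code i))) (unique-allFin-↭ (chainOrder-↭ _ (code j)))
      (subst (_⊆B_ {2 + k} (treeSet (tree i))) (same-set i j eq) (λ x∈ → x∈))))
  where
  code : Fin (size (3 +_) (2 +_) k) → ChainCode k
  code = Inverse.from (code↔ k)
  tree : ∀ i → Tree (chainOrder (λ v → v) (code i))
  tree i = chain (λ v → v) (code i)
  facet∈ : ∀ c → treeSet (chain (λ v → v) c) ∈ facets (2 + k)
  facet∈ c = ∈-facets⁺ (2 + k) (treeSet-facet (chain (λ v → v) c) (chainOrder-↭ _ c))
  same-set : ∀ i j → index (facet∈ (code i)) ≡ index (facet∈ (code j)) → treeSet (tree i) ≡ treeSet (tree j)
  same-set i j eq = trans (lookup-index (facet∈ (code i)))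
    (trans (cong (lookup (facets (2 + k))) eq) (sym (lookup-index (facet∈ (code j)))))

-- Numerical estimates

size-word : ∀ m k → size suc (λ _ → m) k ≡ k ! * m ^ k
size-word m zero = refl
size-word m (suc k) = trans (cong (λ s → suc k * (m * s)) (size-word m k)) (regroup k m (k !) (m ^ k))
  where
  regroup : ∀ k m x y → suc k * (m * (x * y)) ≡ suc k * x * (m * y)
  regroup = solve-∀

facets-upper : ∀ j → length (facets (2 + j)) < (2 + j) ! * (2 + j) ^ j
facets-upper j = begin-strict
  length (facets (2 + j))        ≤⟨ facets-≤ (suc j) ⟩
  size suc (λ _ → m) m           ≡⟨ size-word m m ⟩
  -- Strictness comes from enlarging the base; the exponent `m` is positive.
  m ! * m ^ m                    <⟨ *-monoʳ-< (m !) {{m !≢0}} (^-monoˡ-< m (n<1+n m)) ⟩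
  m ! * (suc m * suc m ^ j)      ≡⟨ regroup m (m !) (suc m ^ j) ⟩
  suc m ! * suc m ^ j            ∎
  where
  open ≤-Reasoning
  m = suc j
  regroup : ∀ m x y → x * (suc m * y) ≡ suc m * x * y
  regroup = solve-∀

-- (1 + 1/N) ^ m ≤ N / (N ∸ m) for N = m + d, with denominators cleared.
bernoulli : ∀ m d → suc (m + d) ^ m * d ≤ (m + d) ^ suc m
bernoulli zero d = ≤-reflexive (trans (+-identityʳ d) (sym (*-identityʳ d)))
bernoulli (suc m) d = begin
  suc N * suc N ^ m * d         ≡⟨ regroup N (suc N ^ m) d ⟩
  suc N ^ m * (d + N * d)       ≤⟨ *-monoʳ-≤ (suc N ^ m) (+-monoˡ-≤ (N * d) (m≤n+m d (suc m))) ⟩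
  suc N ^ m * (N + N * d)       ≡⟨ regroup′ N (suc N ^ m) d ⟩
  -- The induction keeps `N` fixed: `m` decreases while `d` increases.
  N * (suc N ^ m * suc d)       ≤⟨ *-monoʳ-≤ N (subst (λ n → suc n ^ m * suc d ≤ n ^ suc m) (+-suc m d) (bernoulli m (suc d))) ⟩
  N * N ^ suc m                 ∎
  where
  open ≤-Reasoning
  N = suc m + d
  regroup : ∀ n x d → suc n * x * d ≡ x * (d + n * d)
  regroup = solve-∀
  regroup′ : ∀ n x d → x * (n + n * d) ≡ n * (x * suc d)
  regroup′ = solve-∀

-- For three vertices both sides equal 6, so the induction starts at four vertices, with 64 < 72.
size-chain : ∀ j → 2 ^ (2 + j) * (4 + j) ^ (2 + j) < size (3 +_) (2 +_) (2 + j)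
size-chain zero = toWitness {a? = 64 <? 72} _
size-chain (suc j) = begin-strict
  2 * 2 ^ k * ((3 + k) * (3 + k) ^ k)         ≡⟨ regroup (2 ^ k) (3 + k) ((3 + k) ^ k) ⟩
  -- With `d = 2` and N = k + 2, `bernoulli` absorbs the additional factor 2.
  (3 + k) * (2 ^ k * ((3 + k) ^ k * 2))       ≤⟨ *-monoʳ-≤ (3 + k) (*-monoʳ-≤ (2 ^ k) (subst (λ n → suc n ^ k * 2 ≤ n ^ suc k) (+-comm k 2) (bernoulli k 2))) ⟩
  (3 + k) * (2 ^ k * ((2 + k) * (2 + k) ^ k)) ≡⟨ cong ((3 + k) *_) (swap-factors (2 ^ k) (2 + k) _) ⟩
  (3 + k) * ((2 + k) * (2 ^ k * (2 + k) ^ k)) <⟨ *-monoʳ-< (3 + k) (*-monoʳ-< (2 + k) (size-chain j)) ⟩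
  (3 + k) * ((2 + k) * size (3 +_) (2 +_) k)  ∎
  where
  open ≤-Reasoning
  k = 2 + j
  regroup : ∀ x y z → 2 * x * (y * z) ≡ y * (x * (z * 2))
  regroup = solve-∀
  swap-factors : ∀ x y z → x * (y * z) ≡ y * (x * z)
  swap-factors = solve-∀

theorem5p24 : (∀ (n : ℕ) → 2 ≤ n → ∃ λ (k : ℕ) → FacetCount n k × k < (n !) * n ^ (n ∸ 2))
    × (∀ (n : ℕ) → 4 ≤ n → ∃ λ (k : ℕ) → FacetCount n k × k > 2 ^ (n ∸ 2) * n ^ (n ∸ 2))
theorem5p24 = upper , lower
  where
  upper : ∀ n → 2 ≤ n → ∃ λ k → FacetCount n k × k < (n !) * n ^ (n ∸ 2)
  upper (suc (suc j)) (s≤s (s≤s z≤n)) = length (facets (2 + j)) , facetCount (2 + j) , facets-upper j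
  lower : ∀ n → 4 ≤ n → ∃ λ k → FacetCount n k × k > 2 ^ (n ∸ 2) * n ^ (n ∸ 2)
  lower (suc (suc (suc (suc j)))) (s≤s (s≤s (s≤s (s≤s z≤n)))) =
    length (facets (4 + j)) , facetCount (4 + j) , <-≤-trans (size-chain j) (facets-≥ (2 + j))
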